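{- Let $G$ be a connected graph that is not a tree, with $m$ edges and edge-connectivity $\lambda$, and let $w$ be a normalised weight function on $E(G)$. Then $$0\leq \mathrm{avec}(G,w)\leq \frac{m}{\lambda}.$$
   Context: Graphs are finite and simple. For a connected graph $G$ with $n$ vertices and $m$ edges, a weight function is a map $w:E(G)\to\mathbb{R}^{\geq 0}$; it is called normalised if $\sum_{e\in E(G)}w(e)=m$. The weighted distance $d_w(u,v)$ is the minimum, over all paths between $u$ and $v$ in $G$, of the sum of the weights of the edges of the path. The weighted eccentricity of a vertex $v$ is $e_w(v)=\max_{u\in V(G)}d_w(u,v)$, and the average eccentricity is $\mathrm{avec}(G,w)=\frac1n\sum_{v\in V(G)}e_w(v)$. The edge-connectivity $\lambda$ of $G$ is the smallest number of edges whose deletion disconnects $G$. -}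

module Defs where

open import Data.Empty using (⊥-elim)
open import Data.Fin using (Fin; _≟_)
open import Data.Fin.Properties using (injective⇒≤)
open import Data.Fin.Subset using (Subset; ∣_∣; _∉_)
open import Data.Fin.Subset.Properties using (x∈p⇒∣p-x∣<∣p∣)
open import Data.Integer as ℤ using (+_)
open import Data.List as List using (List; []; _∷_; foldr; map; concatMap; allFin; upTo; filter; length; lookup)
open import Data.List.Membership.Propositional as ∈ using (_∈_)
open import Data.List.Membership.Propositional.Properties
  using (∈-map⁺; ∈-concatMap⁺; ∈-allFin; ∈-upTo⁺; ∈-filter⁺)
open import Data.List.Relation.Unary.All as All using (All; []; _∷_)
open import Data.List.Relation.Unary.Any using (here; there)
open import Data.List.Relation.Unary.Unique.Propositional using (Unique; []; _∷_)
open import Data.Nat as ℕ using (ℕ; zero; suc; NonZero)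
import Data.Nat.Properties as ℕ
open import Data.Product using (Σ; Σ-syntax; ∃; ∃-syntax; _×_; _,_; proj₁; proj₂)
open import Data.Rational as ℚ using (ℚ; 0ℚ; 1ℚ; ½)
import Data.Rational.Properties as ℚ
import Data.Rational.Unnormalised as ℚᵘ
import Data.Rational.Unnormalised.Properties as ℚᵘ
open import Data.Rational.Solver using (module +-*-Solver)
open import Data.Sum using (_⊎_; inj₁; inj₂)
import Data.Vec.Functional as Vector
open import Function using (_∘_)
open import Relation.Binary.PropositionalEquality
open import Relation.Nullary using (¬_; Dec; yes; no)
open import Relation.Nullary.Decidable using (_×-dec_; _⊎-dec_)
open import Axiom.UniquenessOfIdentityProofs using (module Decidable⇒UIP)

import Data.List.Relation.Unary.Unique.DecPropositional as DecUnique

private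
  open +-*-Solver using (solve; _:=_; _:+_; _:-_; _:*_; :-_)

  ∣-∣≤⇒≤ : ∀ {p q ε} → ℚ.∣ p ℚ.- q ∣ ℚ.≤ ε → p ℚ.≤ q ℚ.+ ε
  ∣-∣≤⇒≤ {p} {q} {ε} h = begin
    p                      ≡⟨ lem p q ⟩
    q ℚ.+ (p ℚ.- q)        ≤⟨ ℚ.+-monoʳ-≤ q (ℚ.≤-trans (p≤∣p∣ (p ℚ.- q)) h) ⟩
    q ℚ.+ ε                ∎
    where
    open ℚ.≤-Reasoning
    lem : ∀ p q → p ≡ q ℚ.+ (p ℚ.- q)
    lem = solve 2 (λ p q → p := q :+ (p :- q)) refl
    p≤∣p∣ : ∀ p → p ℚ.≤ ℚ.∣ p ∣
    p≤∣p∣ p with ℚ.≤-total 0ℚ p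
    ... | inj₁ 0≤p = ℚ.≤-reflexive (sym (ℚ.0≤p⇒∣p∣≡p 0≤p))
    ... | inj₂ p≤0 = ℚ.≤-trans p≤0 (ℚ.0≤∣p∣ p)

  ∣-∣-sym : ∀ p q → ℚ.∣ p ℚ.- q ∣ ≡ ℚ.∣ q ℚ.- p ∣
  ∣-∣-sym p q = trans (sym (ℚ.∣-p∣≡∣p∣ (p ℚ.- q))) (cong ℚ.∣_∣ (lem p q))
    where
    lem : ∀ p q → ℚ.- (p ℚ.- q) ≡ q ℚ.- p
    lem = solve 2 (λ p q → :- (p :- q) := q :- p) refl

  ≤⇒∣-∣≤ : ∀ {p q ε} → p ℚ.≤ q ℚ.+ ε → q ℚ.≤ p ℚ.+ ε → ℚ.∣ p ℚ.- q ∣ ℚ.≤ ε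
  ≤⇒∣-∣≤ {p} {q} {ε} h k with ℚ.∣p∣≡p∨∣p∣≡-p (p ℚ.- q)
  ... | inj₁ eq = subst (ℚ._≤ ε) (sym eq) (diff p q h)
    where
    lem : ∀ q ε → (q ℚ.+ ε) ℚ.- q ≡ ε
    lem = solve 2 (λ q ε → (q :+ ε) :- q := ε) refl
    diff : ∀ p q → p ℚ.≤ q ℚ.+ ε → p ℚ.- q ℚ.≤ ε
    diff p q h = ℚ.≤-trans (ℚ.+-monoˡ-≤ (ℚ.- q) h) (ℚ.≤-reflexive (lem q ε))
  ... | inj₂ eq = subst (ℚ._≤ ε) (sym eq) (begin
    ℚ.- (p ℚ.- q)      ≡⟨ lem₁ p q ⟩
    q ℚ.- p            ≤⟨ ℚ.+-monoˡ-≤ (ℚ.- p) k ⟩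
    (p ℚ.+ ε) ℚ.- p    ≡⟨ lem₂ p ε ⟩
    ε                  ∎)
    where
    open ℚ.≤-Reasoning
    lem₁ : ∀ p q → ℚ.- (p ℚ.- q) ≡ q ℚ.- p
    lem₁ = solve 2 (λ p q → :- (p :- q) := q :- p) refl
    lem₂ : ∀ q ε → (q ℚ.+ ε) ℚ.- q ≡ ε
    lem₂ = solve 2 (λ q ε → (q :+ ε) :- q := ε) refl

  ½-pos : ∀ {ε} → 0ℚ ℚ.< ε → 0ℚ ℚ.< ½ ℚ.* ε
  ½-pos {ε} 0<ε = ℚ.<-respˡ-≡ (ℚ.*-zeroʳ ½) (ℚ.*-monoʳ-<-pos ½ 0<ε)

  +-close : ∀ {a b c d ε} → ℚ.∣ a ℚ.- c ∣ ℚ.≤ ½ ℚ.* ε → ℚ.∣ b ℚ.- d ∣ ℚ.≤ ½ ℚ.* ε →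
            ℚ.∣ (a ℚ.+ b) ℚ.- (c ℚ.+ d) ∣ ℚ.≤ ε
  +-close {a} {b} {c} {d} {ε} h k = begin
    ℚ.∣ (a ℚ.+ b) ℚ.- (c ℚ.+ d) ∣         ≡⟨ cong ℚ.∣_∣ (lem a b c d) ⟩
    ℚ.∣ (a ℚ.- c) ℚ.+ (b ℚ.- d) ∣         ≤⟨ ℚ.∣p+q∣≤∣p∣+∣q∣ (a ℚ.- c) (b ℚ.- d) ⟩
    ℚ.∣ a ℚ.- c ∣ ℚ.+ ℚ.∣ b ℚ.- d ∣       ≤⟨ ℚ.+-mono-≤ h k ⟩
    ½ ℚ.* ε ℚ.+ ½ ℚ.* ε                   ≡⟨ ℚ.*-distribʳ-+ ε ½ ½ ⟨
    1ℚ ℚ.* ε                              ≡⟨ ℚ.*-identityˡ ε ⟩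
    ε                                     ∎
    where
    open ℚ.≤-Reasoning
    lem : ∀ a b c d → (a ℚ.+ b) ℚ.- (c ℚ.+ d) ≡ (a ℚ.- c) ℚ.+ (b ℚ.- d)
    lem = solve 4 (λ a b c d → (a :+ b) :- (c :+ d) := (a :- c) :+ (b :- d)) refl

  ⊔-close : ∀ {a b c d ε} → ℚ.∣ a ℚ.- c ∣ ℚ.≤ ε → ℚ.∣ b ℚ.- d ∣ ℚ.≤ ε →
            ℚ.∣ (a ℚ.⊔ b) ℚ.- (c ℚ.⊔ d) ∣ ℚ.≤ ε
  ⊔-close {a} {b} {c} {d} {ε} h k = ≤⇒∣-∣≤ {a ℚ.⊔ b} {c ℚ.⊔ d}
    (half {a} {b} {c} {d} (∣-∣≤⇒≤ {a} {c} h) (∣-∣≤⇒≤ {b} {d} k))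
    (half {c} {d} {a} {b} (∣-∣≤⇒≤ {c} {a} (subst (ℚ._≤ ε) (∣-∣-sym a c) h))
          (∣-∣≤⇒≤ {d} {b} (subst (ℚ._≤ ε) (∣-∣-sym b d) k)))
    where
    half : ∀ {a b c d} → a ℚ.≤ c ℚ.+ ε → b ℚ.≤ d ℚ.+ ε → a ℚ.⊔ b ℚ.≤ (c ℚ.⊔ d) ℚ.+ ε
    half {a} {b} {c} {d} h k = ℚ.⊔-lub
      (ℚ.≤-trans h (ℚ.+-monoˡ-≤ ε (ℚ.p≤p⊔q c d)))
      (ℚ.≤-trans k (ℚ.+-monoˡ-≤ ε (ℚ.p≤q⊔p c d)))

  ⊓-close : ∀ {a b c d ε} → ℚ.∣ a ℚ.- c ∣ ℚ.≤ ε → ℚ.∣ b ℚ.- d ∣ ℚ.≤ ε →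
            ℚ.∣ (a ℚ.⊓ b) ℚ.- (c ℚ.⊓ d) ∣ ℚ.≤ ε
  ⊓-close {a} {b} {c} {d} {ε} h k = ≤⇒∣-∣≤ {a ℚ.⊓ b} {c ℚ.⊓ d}
    (half {a} {b} {c} {d} (∣-∣≤⇒≤ {a} {c} h) (∣-∣≤⇒≤ {b} {d} k))
    (half {c} {d} {a} {b} (∣-∣≤⇒≤ {c} {a} (subst (ℚ._≤ ε) (∣-∣-sym a c) h))
                          (∣-∣≤⇒≤ {d} {b} (subst (ℚ._≤ ε) (∣-∣-sym b d) k)))
    where
    half : ∀ {a b c d} → a ℚ.≤ c ℚ.+ ε → b ℚ.≤ d ℚ.+ ε → a ℚ.⊓ b ℚ.≤ (c ℚ.⊓ d) ℚ.+ ε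
    half {a} {b} {c} {d} h k with ℚ.⊓-sel c d
    ... | inj₁ eq rewrite eq = ℚ.≤-trans (ℚ.p⊓q≤p a b) h
    ... | inj₂ eq rewrite eq = ℚ.≤-trans (ℚ.p⊓q≤q a b) k

  1/n≤1 : ∀ n .{{_ : NonZero n}} → (+ 1 ℚ./ n) ℚ.≤ 1ℚ
  1/n≤1 n@(suc k) = ℚ.toℚᵘ-cancel-≤ (ℚᵘ.≤-respˡ-≃
    (ℚᵘ.≃-sym (ℚ.toℚᵘ-fromℚᵘ (ℚᵘ.mkℚᵘ (+ 1) k)))
    (ℚᵘ.*≤* (ℤ.+≤+ (ℕ.s≤s ℕ.z≤n))))

  /-close : ∀ {p q ε} n .{{_ : NonZero n}} → ℚ.∣ p ℚ.- q ∣ ℚ.≤ ε →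
            ℚ.∣ p ℚ.* (+ 1 ℚ./ n) ℚ.- q ℚ.* (+ 1 ℚ./ n) ∣ ℚ.≤ ε
  /-close {p} {q} {ε} n h = begin
    ℚ.∣ p ℚ.* r ℚ.- q ℚ.* r ∣       ≡⟨ cong ℚ.∣_∣ (lem p q r) ⟩
    ℚ.∣ (p ℚ.- q) ℚ.* r ∣           ≡⟨ ℚ.∣p*q∣≡∣p∣*∣q∣ (p ℚ.- q) r ⟩
    ℚ.∣ p ℚ.- q ∣ ℚ.* ℚ.∣ r ∣       ≤⟨ ℚ.*-monoˡ-≤-nonNeg ℚ.∣ p ℚ.- q ∣ {{ℚ.∣-∣-nonNeg (p ℚ.- q)}} ∣r∣≤1 ⟩
    ℚ.∣ p ℚ.- q ∣ ℚ.* 1ℚ            ≡⟨ ℚ.*-identityʳ _ ⟩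
    ℚ.∣ p ℚ.- q ∣                   ≤⟨ h ⟩
    ε                               ∎
    where
    open ℚ.≤-Reasoning
    r = + 1 ℚ./ n
    lem : ∀ p q r → p ℚ.* r ℚ.- q ℚ.* r ≡ (p ℚ.- q) ℚ.* r
    lem = solve 3 (λ p q r → p :* r :- q :* r := (p :- q) :* r) refl
    ∣r∣≤1 : ℚ.∣ r ∣ ℚ.≤ 1ℚ
    ∣r∣≤1 = subst (ℚ._≤ 1ℚ)
      (sym (ℚ.0≤p⇒∣p∣≡p (ℚ.nonNegative⁻¹ r {{ℚ.normalize-nonNeg 1 n}}))) (1/n≤1 n)

-- Real numbers are Cauchy sequences of rationals, identified up to _≃_.
-- The operations below act termwise.

IsCauchy : (ℕ → ℚ) → Set
IsCauchy x = ∀ ε → 0ℚ ℚ.< ε →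
  ∃[ N ] (∀ i j → N ℕ.≤ i → N ℕ.≤ j → ℚ.∣ x i ℚ.- x j ∣ ℚ.≤ ε)

record ℝ : Set where
  constructor mkℝ
  field
    seq    : ℕ → ℚ
    cauchy : IsCauchy seq

open ℝ public

infix  4 _≤_ _≃_
infixl 6 _+_ _⊓_ _⊔_
infixl 7 _÷_

_≤_ : ℝ → ℝ → Set
x ≤ y = ∀ ε → 0ℚ ℚ.< ε → ∃[ N ] (∀ i → N ℕ.≤ i → seq x i ℚ.≤ seq y i ℚ.+ ε)

_≃_ : ℝ → ℝ → Set
x ≃ y = x ≤ y × y ≤ x

fromℚ : ℚ → ℝ
fromℚ q = mkℝ (λ _ → q) λ ε 0<ε → 0 , λ _ _ _ _ →
  ℚ.≤-trans (ℚ.≤-reflexive (cong ℚ.∣_∣ (ℚ.+-inverseʳ q))) (ℚ.<⇒≤ 0<ε)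

fromℕ : ℕ → ℝ
fromℕ k = fromℚ (+ k ℚ./ 1)

0ℝ : ℝ
0ℝ = fromℕ 0

_+_ : ℝ → ℝ → ℝ
x + y = mkℝ (λ i → seq x i ℚ.+ seq y i) λ ε 0<ε →
  let (M , f) = cauchy x (½ ℚ.* ε) (½-pos 0<ε)
      (N , g) = cauchy y (½ ℚ.* ε) (½-pos 0<ε)
  in M ℕ.⊔ N , λ i j h k →
     +-close {seq x i} {seq y i} {seq x j} {seq y j}
       (f i j (ℕ.m⊔n≤o⇒m≤o M N h) (ℕ.m⊔n≤o⇒m≤o M N k))
       (g i j (ℕ.m⊔n≤o⇒n≤o M N h) (ℕ.m⊔n≤o⇒n≤o M N k))

_⊔_ : ℝ → ℝ → ℝ
x ⊔ y = mkℝ (λ i → seq x i ℚ.⊔ seq y i) λ ε 0<ε →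
  let (M , f) = cauchy x ε 0<ε
      (N , g) = cauchy y ε 0<ε
  in M ℕ.⊔ N , λ i j h k →
     ⊔-close {seq x i} {seq y i} {seq x j} {seq y j}
       (f i j (ℕ.m⊔n≤o⇒m≤o M N h) (ℕ.m⊔n≤o⇒m≤o M N k))
       (g i j (ℕ.m⊔n≤o⇒n≤o M N h) (ℕ.m⊔n≤o⇒n≤o M N k))

_⊓_ : ℝ → ℝ → ℝ
x ⊓ y = mkℝ (λ i → seq x i ℚ.⊓ seq y i) λ ε 0<ε →
  let (M , f) = cauchy x ε 0<ε
      (N , g) = cauchy y ε 0<ε
  in M ℕ.⊔ N , λ i j h k →
     ⊓-close {seq x i} {seq y i} {seq x j} {seq y j}
       (f i j (ℕ.m⊔n≤o⇒m≤o M N h) (ℕ.m⊔n≤o⇒m≤o M N k))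
       (g i j (ℕ.m⊔n≤o⇒n≤o M N h) (ℕ.m⊔n≤o⇒n≤o M N k))

_÷_ : ℝ → (n : ℕ) .{{_ : NonZero n}} → ℝ
x ÷ n = mkℝ (λ i → seq x i ℚ.* (+ 1 ℚ./ n)) λ ε 0<ε →
  let (N , f) = cauchy x ε 0<ε
  in N , λ i j h k → /-close {seq x i} {seq x j} n (f i j h k)

∑ : ∀ {k} → (Fin k → ℝ) → ℝ
∑ = Vector.foldr _+_ 0ℝ

-- Vertices and edges are numbered; each edge lists its two ends in an
-- arbitrary order, which `Joins` forgets.  As usual, a graph has at least
-- one vertex.
record Graph : Set where
  field
    ∣V∣ ∣E∣      : ℕ
    {{nonempty}} : NonZero ∣V∣

  V : Set
  V = Fin ∣V∣

  E : Set
  E = Fin ∣E∣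

  field
    end₁ end₂ : E → V

  Joins : E → V → V → Set
  Joins e u v = (end₁ e ≡ u × end₂ e ≡ v) ⊎ (end₁ e ≡ v × end₂ e ≡ u)

  field
    loopless   : ∀ e → end₁ e ≢ end₂ e
    noParallel : ∀ {e f u v} → Joins e u v → Joins f u v → e ≡ f

module _ (G : Graph) where
  open Graph G

  infixr 5 _by_∷_

  data Walk : V → V → Set where
    []     : ∀ {v} → Walk v v
    _by_∷_ : ∀ {u v x} (e : E) → Joins e u x → Walk x v → Walk u v

module _ {G : Graph} where
  open Graph G

  edges : ∀ {u v} → Walk G u v → List E
  edges []           = []
  edges (e by _ ∷ p) = e ∷ edges p

  vertices : ∀ {u v} → Walk G u v → List V
  vertices {u} []           = u ∷ []
  vertices {u} (_ by _ ∷ p) = u ∷ vertices p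

  IsPath : ∀ {u v} → Walk G u v → Set
  IsPath p = Unique (vertices p)

module _ (G : Graph) where
  open Graph G

  Path : V → V → Set
  Path u v = Σ[ p ∈ Walk G u v ] IsPath p

  Connected : Set
  Connected = ∀ u v → Path u v

  -- In a simple graph, a cycle is a path with at least two edges together
  -- with an edge joining its ends.
  Cycle : Set
  Cycle = ∃[ u ] ∃[ v ] Σ[ p ∈ Path u v ] Σ[ e ∈ E ]
            (2 ℕ.≤ length (edges (proj₁ p)) × Joins e v u)

  IsTree : Set
  IsTree = Connected × ¬ Cycle

  -- The graph with the edges in S deleted is connected.
  ConnectedWithout : Subset ∣E∣ → Set
  ConnectedWithout S = ∀ u v → Σ[ p ∈ Path u v ] All (_∉ S) (edges (proj₁ p))

  IsEdgeConnectivity : ℕ → Set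
  IsEdgeConnectivity k =
    (∃[ S ] (∣ S ∣ ≡ k × ¬ ConnectedWithout S)) ×
    (∀ S → ¬ ConnectedWithout S → k ℕ.≤ ∣ S ∣)

  edgeConnectivity-nonZero : ∀ {k} → Connected → IsEdgeConnectivity k → NonZero k
  edgeConnectivity-nonZero {suc _} _ _ = _
  edgeConnectivity-nonZero {zero} conn ((S , ∣S∣≡0 , disc) , _) =
    ⊥-elim (disc λ u v → conn u v , All.tabulate λ {e} _ → S-empty e)
    where
    S-empty : ∀ e → e ∉ S
    S-empty e e∈S = ℕ.n≮0 (ℕ.<-≤-trans (x∈p⇒∣p-x∣<∣p∣ e∈S) (ℕ.≤-reflexive ∣S∣≡0))

  joins? : ∀ e u v → Dec (Joins e u v)
  joins? e u v = (end₁ e ≟ u ×-dec end₂ e ≟ v) ⊎-dec (end₁ e ≟ v ×-dec end₂ e ≟ u)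

  trivialWalks : ∀ u v → List (Walk G u v)
  trivialWalks u v with u ≟ v
  ... | yes refl = [] ∷ []
  ... | no  _    = []

  extendBy : ∀ {u v x} → E → List (Walk G x v) → List (Walk G u v)
  extendBy {u} {v} {x} e ps with joins? e u x
  ... | yes j = map (e by j ∷_) ps
  ... | no  _ = []

  walksOfLength : ℕ → ∀ u v → List (Walk G u v)
  walksOfLength zero    u v = trivialWalks u v
  walksOfLength (suc k) u v =
    concatMap (λ e → concatMap (λ x → extendBy e (walksOfLength k x v)) (allFin ∣V∣)) (allFin ∣E∣)

  -- The walks without repeated vertices; such a walk has fewer than ∣V∣
  -- edges, so none is missed (`paths-complete`).
  paths : ∀ u v → List (Walk G u v)
  paths u v = filter (λ p → unique? (vertices p))
                (concatMap (λ k → walksOfLength k u v) (upTo ∣V∣))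
    where open DecUnique (_≟_ {∣V∣}) using (unique?)

  private
    joins-irrelevant : ∀ {e u v} (j k : Joins e u v) → j ≡ k
    joins-irrelevant (inj₁ (a , b)) (inj₁ (c , d)) =
      cong inj₁ (cong₂ _,_ (uip a c) (uip b d))
      where open Decidable⇒UIP _≟_ renaming (≡-irrelevant to uip)
    joins-irrelevant (inj₂ (a , b)) (inj₂ (c , d)) =
      cong inj₂ (cong₂ _,_ (uip a c) (uip b d))
      where open Decidable⇒UIP _≟_ renaming (≡-irrelevant to uip)
    joins-irrelevant {e} (inj₁ (a , b)) (inj₂ (c , d)) = ⊥-elim (loopless e (trans a (sym d)))
    joins-irrelevant {e} (inj₂ (a , b)) (inj₁ (c , d)) = ⊥-elim (loopless e (trans c (sym b)))

    trivialWalks-complete : ∀ u → [] ∈ trivialWalks u u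
    trivialWalks-complete u with u ≟ u
    ... | yes refl = here refl
    ... | no  u≢u  = ⊥-elim (u≢u refl)

    extendBy-complete : ∀ {u v x} e (j : Joins e u x) {p : Walk G x v} {ps} →
                        p ∈ ps → (e by j ∷ p) ∈ extendBy e ps
    extendBy-complete {u} {v} {x} e j {p} p∈ps with joins? e u x
    ... | yes k = subst (λ i → (e by i ∷ p) ∈ map (e by k ∷_) _) (joins-irrelevant k j)
                    (∈-map⁺ (e by k ∷_) p∈ps)
    ... | no ¬j = ⊥-elim (¬j j)

    walksOfLength-complete : ∀ {u v} (p : Walk G u v) → p ∈ walksOfLength (length (edges p)) u v
    walksOfLength-complete {u} [] = trivialWalks-complete u
    walksOfLength-complete (_by_∷_ {x = x} e j p) =
      ∈-concatMap⁺ _ (∈.lose (∈-allFin e)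
        (∈-concatMap⁺ _ (∈.lose (∈-allFin x) (extendBy-complete e j (walksOfLength-complete p)))))

    unique-lookup : ∀ {k} {xs : List (Fin k)} → Unique xs → ∀ {i j} →
                    lookup xs i ≡ lookup xs j → i ≡ j
    unique-lookup (_ ∷ _)   {Fin.zero}  {Fin.zero}  _  = refl
    unique-lookup (x ∷ _)   {Fin.zero}  {Fin.suc j} eq = ⊥-elim (All.lookup x (∈-lk j) eq)
      where
      ∈-lk : ∀ {A : Set} {xs : List A} j → lookup xs j ∈ xs
      ∈-lk {xs = _ ∷ _} Fin.zero    = here refl
      ∈-lk {xs = _ ∷ _} (Fin.suc j) = there (∈-lk j)
    unique-lookup (x ∷ u)   {Fin.suc i} {Fin.zero}  eq = sym (unique-lookup (x ∷ u) {Fin.zero} {Fin.suc i} (sym eq))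
    unique-lookup (_ ∷ u)   {Fin.suc i} {Fin.suc j} eq = cong Fin.suc (unique-lookup u eq)

    length-vertices : ∀ {u v} (p : Walk G u v) → length (vertices p) ≡ suc (length (edges p))
    length-vertices []           = refl
    length-vertices (_ by _ ∷ p) = cong suc (length-vertices p)

  paths-complete : ∀ {u v} ((p , _) : Path u v) → p ∈ paths u v
  paths-complete {u} {v} (p , uniq) = ∈-filter⁺ (λ p → unique? (vertices p))
    (∈-concatMap⁺ (λ k → walksOfLength k u v)
      (∈.lose (∈-upTo⁺ short) (walksOfLength-complete p))) uniq
    where
    open DecUnique (_≟_ {∣V∣}) using (unique?)
    short : length (edges p) ℕ.< ∣V∣
    short = subst (ℕ._≤ ∣V∣) (length-vertices p) (injective⇒≤ (unique-lookup uniq))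

  Weight : Set
  Weight = E → ℝ

  NonNegative : Weight → Set
  NonNegative w = ∀ e → 0ℝ ≤ w e

  Normalised : Weight → Set
  Normalised w = ∑ w ≃ fromℕ ∣E∣

  pathWeight : Weight → ∀ {u v} → Walk G u v → ℝ
  pathWeight w p = foldr _+_ 0ℝ (map w (edges p))

  module _ (conn : Connected) (w : Weight) where

    -- The fold starts from the weight of one of the paths, so it is the
    -- minimum over all of them.
    dist : V → V → ℝ
    dist u v = foldr _⊓_ (pathWeight w (proj₁ (conn u v))) (map (pathWeight w) (paths u v))

    ecc : V → ℝ
    ecc v = Vector.foldr _⊔_ (dist v v) (λ u → dist u v)

    avec : ℝ
    avec = ∑ ecc ÷ ∣V∣

{-# OPTIONS --safe #-}
module Submission where

-- Upper bound.  Let natural weights a be given, fix v, and let f x be the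
-- distance from x to v.  Then f v = 0, and f changes by at most a e along each
-- edge e, so the total weight is at least the variation of f, the sum of
-- |f x - f y| over the edges xy (`distℕ-variation`).  The variation is computed
-- layer by layer: replacing f by its predecessor (with 0 kept at 0) decreases
-- |f x - f y| by one exactly when one of f x, f y is zero and the other is not,
-- and otherwise leaves it unchanged, so it decreases the variation by the size
-- of the edge cut around the zero set of f.  As long as f u is positive, that
-- cut separates u from v and so has at least k edges, k being the
-- edge-connectivity.  After f u steps this gives
-- f u * k <= variation of f <= total weight (`variation-bound`).
--
-- Nonnegative rational weights are natural multiples of a common unit
-- (`commonUnit`), which gives a path from u to v of weight at most 1/k times
-- the total (`lightPath`).  Real weights are Cauchy sequences on which sums,
-- minima and maxima act termwise, so the rational bound is applied at each
-- sufficiently large index.  At such an index a weight may be slightly negative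
-- and the sum of the weights slightly larger than the number of edges; a small
-- constant added to every weight makes them nonnegative, and the resulting
-- error tends to zero (`dist-upper`).  The maximum and the average inherit the bound
-- (`avec-upper`).
--
-- Lower bound.  The only path from a vertex to itself is the empty one, so the
-- distance from v to v, and with it every eccentricity, is nonnegative at each
-- index (`0≤avec`).

open import Defs
open import Algebra.Bundles using (CommutativeRing)
import Algebra.Properties.Semiring.Sum as Sum
open import Data.Bool using (Bool; true; false; if_then_else_)
open import Data.Empty using (⊥-elim)
open import Data.Fin using (Fin; zero; suc; _≟_)
open import Data.Fin.Subset using (Subset; ∣_∣; _∉_)
open import Data.Integer as ℤ using (+_; -[1+_])
import Data.Integer.Properties as ℤ
open import Data.List using ([]; _∷_; foldr; map; concatMap; upTo)
open import Data.List.Extrema.Nat using (argmin; argmin-all; f[argmin]≤f[xs])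
open import Data.List.Membership.Propositional using (_∈_)
open import Data.List.Membership.Propositional.Properties using (∈-map⁺)
open import Data.List.Relation.Unary.All as All using (All; []; _∷_)
open import Data.List.Relation.Unary.All.Properties using (¬Any⇒All¬; all-filter; map⁺)
open import Data.List.Relation.Unary.Any using (here; there)
open import Data.List.Relation.Unary.Unique.Propositional using ([]; _∷_)
open import Data.Nat as ℕ using (ℕ; zero; suc; pred; NonZero; z≤n; ∣_-_∣)
import Data.Nat.ListAction as ℕ
import Data.Nat.Properties as ℕ
open import Data.Product using (Σ-syntax; ∃-syntax; _×_; _,_; proj₁; proj₂)
open import Data.Rational as ℚ using (ℚ; 0ℚ; 1ℚ; ½)
import Data.Rational.Properties as ℚ
open import Data.Rational.Solver using (module +-*-Solver)
import Data.Rational.Unnormalised as ℚᵘ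
import Data.Rational.Unnormalised.Properties as ℚᵘ
open import Data.Sum using (inj₁; inj₂)
import Data.Vec as Vec
import Data.Vec.Functional as Vector
import Data.Vec.Properties as Vec
open import Relation.Binary.PropositionalEquality
open import Relation.Nullary using (¬_; yes; no)

open Sum ℕ.+-*-semiring using () renaming (sum to sumℕ; ∑-distrib-+ to sumℕ-distrib-+)
open Sum (CommutativeRing.semiring ℚ.+-*-commutativeRing)
  using () renaming (sum to sumℚ; sum-cong-≗ to sumℚ-cong)
open +-*-Solver using (solve; _:=_; _:+_; _:*_)

import Data.List.Membership.DecPropositional as DecMembership
import Data.List.Relation.Unary.Unique.DecPropositional as DecUnique

-- Potentials and edge cuts

sumℕ-mono : ∀ {n} {f g : Fin n → ℕ} → (∀ j → f j ℕ.≤ g j) → sumℕ f ℕ.≤ sumℕ g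
sumℕ-mono {zero}  f≤g = z≤n
sumℕ-mono {suc n} f≤g = ℕ.+-mono-≤ (f≤g zero) (sumℕ-mono λ j → f≤g (suc j))

indicator : Bool → ℕ
indicator b = if b then 1 else 0

∣tabulate∣ : ∀ {n} (b : Fin n → Bool) → ∣ Vec.tabulate b ∣ ≡ sumℕ (λ j → indicator (b j))
∣tabulate∣ {zero}  b = refl
∣tabulate∣ {suc n} b with b zero
... | true  = cong suc (∣tabulate∣ λ j → b (suc j))
... | false = ∣tabulate∣ λ j → b (suc j)

-- The boolean telling whether exactly one of the two numbers is zero.
straddle : ℕ → ℕ → Bool
straddle zero    zero    = false
straddle zero    (suc _) = true
straddle (suc _) zero    = true
straddle (suc _) (suc _) = false

∣-∣-pred : ∀ x y → ∣ x - y ∣ ≡ indicator (straddle x y) ℕ.+ ∣ pred x - pred y ∣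
∣-∣-pred zero    zero    = refl
∣-∣-pred zero    (suc y) = refl
∣-∣-pred (suc x) zero    = cong suc (sym (ℕ.∣-∣-identityʳ x))
∣-∣-pred (suc x) (suc y) = refl

module _ (G : Graph) where
  open Graph G

  -- The edges with exactly one end in the zero set of f.
  zeroCut : (V → ℕ) → Subset ∣E∣
  zeroCut f = Vec.tabulate λ e → straddle (f (end₁ e)) (f (end₂ e))

  zeroCut-step : ∀ f {e x y} → Joins e x y → e ∉ zeroCut f → f y ≡ 0 → f x ≡ 0
  zeroCut-step f {e} {x} {y} j e∉ fy≡0 with f x in fx≡
  ... | zero  = refl
  ... | suc n = ⊥-elim (e∉ (Vec.lookup⇒[]= e (zeroCut f) (trans (Vec.lookup∘tabulate _ e) (crosses j))))
    where
    crosses : Joins e x y → straddle (f (end₁ e)) (f (end₂ e)) ≡ true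
    crosses (inj₁ (refl , refl)) rewrite fx≡ | fy≡0 = refl
    crosses (inj₂ (refl , refl)) rewrite fx≡ | fy≡0 = refl

  zeroCut-walk : ∀ f {x y} (p : Walk G x y) → All (_∉ zeroCut f) (edges p) → f y ≡ 0 → f x ≡ 0
  zeroCut-walk f []           []       fy≡0 = fy≡0
  zeroCut-walk f (e by j ∷ p) (e∉ ∷ p∉) fy≡0 = zeroCut-step f j e∉ (zeroCut-walk f p p∉ fy≡0)

  zeroCut-disconnects : ∀ f {u v} → f u ≢ 0 → f v ≡ 0 → ¬ ConnectedWithout G (zeroCut f)
  zeroCut-disconnects f {u} {v} fu≢0 fv≡0 conn with conn u v
  ... | (p , _) , avoids = fu≢0 (zeroCut-walk f p avoids fv≡0)

  -- The total variation of f over the edges.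
  variation : (V → ℕ) → ℕ
  variation f = sumℕ λ e → ∣ f (end₁ e) - f (end₂ e) ∣

  -- One layer of f contributes the size of the cut around its zero set.
  variation-pred : ∀ f → variation f ≡ ∣ zeroCut f ∣ ℕ.+ variation (λ x → pred (f x))
  variation-pred f = begin
    variation f                                           ≡⟨ sumℕ-cong (λ e → ∣-∣-pred (f (end₁ e)) (f (end₂ e))) ⟩
    sumℕ (λ e → indicator (cut e) ℕ.+ rest e)             ≡⟨ sumℕ-distrib-+ (λ e → indicator (cut e)) rest ⟩
    sumℕ (λ e → indicator (cut e)) ℕ.+ sumℕ rest          ≡⟨ cong (ℕ._+ sumℕ rest) (∣tabulate∣ cut) ⟨
    ∣ zeroCut f ∣ ℕ.+ sumℕ rest                           ∎
    where
    open ≡-Reasoning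
    open Sum ℕ.+-*-semiring using () renaming (sum-cong-≗ to sumℕ-cong)
    cut : E → Bool
    cut e = straddle (f (end₁ e)) (f (end₂ e))
    rest : E → ℕ
    rest e = ∣ pred (f (end₁ e)) - pred (f (end₂ e)) ∣

  module _ {k : ℕ} (cut≥k : ∀ S → ¬ ConnectedWithout G S → k ℕ.≤ ∣ S ∣) where

    -- The induction on D peels off the zero layer of f; the cut around that
    -- layer separates u from v and so has at least k edges.
    variation-bound : ∀ D f {u v} → f u ≡ D → f v ≡ 0 → D ℕ.* k ℕ.≤ variation f
    variation-bound zero    f fu≡  fv≡0 = z≤n
    variation-bound (suc D) f {u} {v} fu≡ fv≡0 = begin
      k ℕ.+ D ℕ.* k                                         ≤⟨ ℕ.+-mono-≤ (cut≥k (zeroCut f) (zeroCut-disconnects f fu≢0 fv≡0))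
                                                                 (variation-bound D (λ x → pred (f x)) (cong pred fu≡) (cong pred fv≡0)) ⟩
      ∣ zeroCut f ∣ ℕ.+ variation (λ x → pred (f x))        ≡⟨ variation-pred f ⟨
      variation f                                           ∎
      where
      open ℕ.≤-Reasoning
      fu≢0 : f u ≢ 0
      fu≢0 fu≡0 with trans (sym fu≡) fu≡0
      ... | ()

-- Weighted distances

module _ {G : Graph} where
  open Graph G

  -- The total weight of a walk, for natural and for rational edge weights.
  weightℕ : (E → ℕ) → ∀ {u v} → Walk G u v → ℕ
  weightℕ a p = ℕ.sum (map a (edges p))

  weightℚ : (E → ℚ) → ∀ {u v} → Walk G u v → ℚ
  weightℚ q p = foldr ℚ._+_ 0ℚ (map q (edges p))

  -- The final part of a path, starting at one of its vertices.
  pathFrom : ∀ (a : E → ℕ) {x y v} (p : Walk G x v) → IsPath p → y ∈ vertices p →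
             Σ[ q ∈ Walk G y v ] (IsPath q × weightℕ a q ℕ.≤ weightℕ a p)
  pathFrom a []           uniq       (here refl) = [] , uniq , ℕ.≤-refl
  pathFrom a (e by j ∷ p) uniq       (here refl) = (e by j ∷ p) , uniq , ℕ.≤-refl
  pathFrom a (e by j ∷ p) (_ ∷ uniq) (there y∈p) =
    let (q , q-path , q≤p) = pathFrom a p uniq y∈p
    in q , q-path , ℕ.m≤n⇒m≤o+n (a e) q≤p

module _ (G : Graph) (conn : Connected G) where
  open Graph G

  paths-are-paths : ∀ u v → All IsPath (paths G u v)
  paths-are-paths u v = all-filter (λ p → unique? (vertices p))
    (concatMap (λ l → walksOfLength G l u v) (upTo ∣V∣))
    where open DecUnique (_≟_ {∣V∣}) using (unique?)

  module _ (a : E → ℕ) (v : V) where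

    -- A path of least weight from x to v.
    geodesic : ∀ x → Walk G x v
    geodesic x = argmin (weightℕ a) (proj₁ (conn x v)) (paths G x v)

    geodesic-isPath : ∀ x → IsPath (geodesic x)
    geodesic-isPath x = argmin-all (weightℕ a) {P = IsPath} (proj₂ (conn x v)) (paths-are-paths x v)

    -- The weighted distance from a vertex to v.
    distℕ : V → ℕ
    distℕ x = weightℕ a (geodesic x)

    distℕ-minimal : ∀ {x} (p : Walk G x v) → IsPath p → distℕ x ℕ.≤ weightℕ a p
    distℕ-minimal {x} p path =
      All.lookup (f[argmin]≤f[xs] (proj₁ (conn x v)) (paths G x v)) (paths-complete G (p , path))

    distℕ-self : distℕ v ≡ 0
    distℕ-self = ℕ.n≤0⇒n≡0 (distℕ-minimal [] ([] ∷ []))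

    -- A shortest path from y to v either passes through x or can be extended
    -- by e to a path from x.
    distℕ-step : ∀ {e x y} → Joins e x y → distℕ x ℕ.≤ distℕ y ℕ.+ a e
    distℕ-step {e} {x} {y} j with DecMembership._∈?_ (_≟_ {∣V∣}) x (vertices (geodesic y))
    ... | yes x∈p =
      let (q , q-path , q≤p) = pathFrom a (geodesic y) (geodesic-isPath y) x∈p
      in ℕ.m≤n⇒m≤n+o (a e) (ℕ.≤-trans (distℕ-minimal q q-path) q≤p)
    ... | no  x∉p = ℕ.≤-trans
      (distℕ-minimal (e by j ∷ geodesic y) (¬Any⇒All¬ _ x∉p ∷ geodesic-isPath y))
      (ℕ.≤-reflexive (ℕ.+-comm (a e) (distℕ y)))

    -- Along an edge e in either direction the distance grows by at most a e.
    distℕ-variation : variation G distℕ ℕ.≤ sumℕ a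
    distℕ-variation = sumℕ-mono bound
      where
      bound : ∀ e → ∣ distℕ (end₁ e) - distℕ (end₂ e) ∣ ℕ.≤ a e
      bound e with ℕ.∣m-n∣≡[m∸n]∨[n∸m] (distℕ (end₁ e)) (distℕ (end₂ e))
      ... | inj₁ eq = ℕ.≤-trans (ℕ.≤-reflexive eq)
                        (ℕ.m≤n+o⇒m∸n≤o _ _ (distℕ-step {e} (inj₁ (refl , refl))))
      ... | inj₂ eq = ℕ.≤-trans (ℕ.≤-reflexive eq)
                        (ℕ.m≤n+o⇒m∸n≤o _ _ (distℕ-step {e} (inj₂ (refl , refl))))

-- Rational weights as multiples of a common unit

fromℚᵘ-homo-+ : ∀ p q → ℚ.fromℚᵘ p ℚ.+ ℚ.fromℚᵘ q ≡ ℚ.fromℚᵘ (p ℚᵘ.+ q)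
fromℚᵘ-homo-+ p q = ℚ.toℚᵘ-injective (begin
  ℚ.toℚᵘ (ℚ.fromℚᵘ p ℚ.+ ℚ.fromℚᵘ q)                ≈⟨ ℚ.toℚᵘ-homo-+ (ℚ.fromℚᵘ p) (ℚ.fromℚᵘ q) ⟩
  ℚ.toℚᵘ (ℚ.fromℚᵘ p) ℚᵘ.+ ℚ.toℚᵘ (ℚ.fromℚᵘ q)      ≈⟨ ℚᵘ.+-cong (ℚ.toℚᵘ-fromℚᵘ p) (ℚ.toℚᵘ-fromℚᵘ q) ⟩
  p ℚᵘ.+ q                                          ≈⟨ ℚ.toℚᵘ-fromℚᵘ (p ℚᵘ.+ q) ⟨
  ℚ.toℚᵘ (ℚ.fromℚᵘ (p ℚᵘ.+ q))                      ∎)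
  where open import Relation.Binary.Reasoning.Setoid ℚᵘ.≃-setoid

fromℚᵘ-homo-* : ∀ p q → ℚ.fromℚᵘ p ℚ.* ℚ.fromℚᵘ q ≡ ℚ.fromℚᵘ (p ℚᵘ.* q)
fromℚᵘ-homo-* p q = ℚ.toℚᵘ-injective (begin
  ℚ.toℚᵘ (ℚ.fromℚᵘ p ℚ.* ℚ.fromℚᵘ q)                ≈⟨ ℚ.toℚᵘ-homo-* (ℚ.fromℚᵘ p) (ℚ.fromℚᵘ q) ⟩
  ℚ.toℚᵘ (ℚ.fromℚᵘ p) ℚᵘ.* ℚ.toℚᵘ (ℚ.fromℚᵘ q)      ≈⟨ ℚᵘ.*-cong (ℚ.toℚᵘ-fromℚᵘ p) (ℚ.toℚᵘ-fromℚᵘ q) ⟩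
  p ℚᵘ.* q                                          ≈⟨ ℚ.toℚᵘ-fromℚᵘ (p ℚᵘ.* q) ⟨
  ℚ.toℚᵘ (ℚ.fromℚᵘ (p ℚᵘ.* q))                      ∎)
  where open import Relation.Binary.Reasoning.Setoid ℚᵘ.≃-setoid

opaque
  -- The inclusion of the naturals in the rationals.  It is opaque because
  -- otherwise it unfolds to a normalised fraction, from which unification
  -- cannot recover n.
  ι : ℕ → ℚ
  ι n = + n ℚ./ 1

  ι-0 : ι 0 ≡ 0ℚ
  ι-0 = refl

  ι-1 : ι 1 ≡ 1ℚ
  ι-1 = refl

  ι-+ : ∀ a b → ι (a ℕ.+ b) ≡ ι a ℚ.+ ι b
  ι-+ a b = sym (trans (fromℚᵘ-homo-+ (ℚᵘ.mkℚᵘ (+ a) 0) (ℚᵘ.mkℚᵘ (+ b) 0))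
    (ℚ.fromℚᵘ-cong {ℚᵘ.mkℚᵘ (+ a) 0 ℚᵘ.+ ℚᵘ.mkℚᵘ (+ b) 0} {ℚᵘ.mkℚᵘ (+ (a ℕ.+ b)) 0} (ℚᵘ.*≡* (cong (ℤ._* + 1)
      (cong₂ ℤ._+_ (ℤ.*-identityʳ (+ a)) (ℤ.*-identityʳ (+ b)))))))

  ι-* : ∀ a b → ι (a ℕ.* b) ≡ ι a ℚ.* ι b
  ι-* a b = sym (trans (fromℚᵘ-homo-* (ℚᵘ.mkℚᵘ (+ a) 0) (ℚᵘ.mkℚᵘ (+ b) 0))
    (ℚ.fromℚᵘ-cong {ℚᵘ.mkℚᵘ (+ a) 0 ℚᵘ.* ℚᵘ.mkℚᵘ (+ b) 0} {ℚᵘ.mkℚᵘ (+ (a ℕ.* b)) 0}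
      (ℚᵘ.*≡* (cong (ℤ._* + 1) (sym (ℤ.pos-* a b))))))

  /-as-* : ∀ a d .{{_ : NonZero d}} → + a ℚ./ d ≡ ι a ℚ.* (+ 1 ℚ./ d)
  /-as-* a d@(suc d-1) = sym (trans (fromℚᵘ-homo-* (ℚᵘ.mkℚᵘ (+ a) 0) (ℚᵘ.mkℚᵘ (+ 1) d-1))
    (ℚ.fromℚᵘ-cong {ℚᵘ.mkℚᵘ (+ a) 0 ℚᵘ.* ℚᵘ.mkℚᵘ (+ 1) d-1} {ℚᵘ.mkℚᵘ (+ a) d-1}
      (ℚᵘ.*≡* (cong₂ ℤ._*_ (ℤ.*-identityʳ (+ a)) (cong +_ (sym (ℕ.+-identityʳ d)))))))

  ι-inverse : ∀ d .{{_ : NonZero d}} → ι d ℚ.* (+ 1 ℚ./ d) ≡ 1ℚ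
  ι-inverse d@(suc d-1) = trans (sym (/-as-* d d))
    (ℚ.fromℚᵘ-cong {ℚᵘ.mkℚᵘ (+ d) d-1} {ℚᵘ.mkℚᵘ (+ 1) 0}
      (ℚᵘ.*≡* (ℤ.*-comm (+ d) (+ 1))))

  0≤ι : ∀ n → 0ℚ ℚ.≤ ι n
  0≤ι n = ℚ.nonNegative⁻¹ (ι n) {{ℚ.normalize-nonNeg n 1}}

0≤1/ : ∀ n .{{_ : NonZero n}} → 0ℚ ℚ.≤ + 1 ℚ./ n
0≤1/ n = ℚ.nonNegative⁻¹ (+ 1 ℚ./ n) {{ℚ.normalize-nonNeg 1 n}}

ι-mono : ∀ {a b} → a ℕ.≤ b → ι a ℚ.≤ ι b
ι-mono {a} {b} a≤b = begin
  ι a                         ≡⟨ ℚ.+-identityʳ (ι a) ⟨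
  ι a ℚ.+ 0ℚ                  ≤⟨ ℚ.+-monoʳ-≤ (ι a) (0≤ι (b ℕ.∸ a)) ⟩
  ι a ℚ.+ ι (b ℕ.∸ a)         ≡⟨ ι-+ a (b ℕ.∸ a) ⟨
  ι (a ℕ.+ (b ℕ.∸ a))         ≡⟨ cong ι (ℕ.m+[n∸m]≡n a≤b) ⟩
  ι b                         ∎
  where open ℚ.≤-Reasoning

*-monoʳ-≤ : ∀ {p q r} → 0ℚ ℚ.≤ r → p ℚ.≤ q → p ℚ.* r ℚ.≤ q ℚ.* r
*-monoʳ-≤ {r = r} 0≤r = ℚ.*-monoʳ-≤-nonNeg r {{ℚ.nonNegative 0≤r}}

*-monoˡ-≤ : ∀ {p q r} → 0ℚ ℚ.≤ r → p ℚ.≤ q → r ℚ.* p ℚ.≤ r ℚ.* q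
*-monoˡ-≤ {r = r} 0≤r = ℚ.*-monoˡ-≤-nonNeg r {{ℚ.nonNegative 0≤r}}

0≤* : ∀ {p q} → 0ℚ ℚ.≤ p → 0ℚ ℚ.≤ q → 0ℚ ℚ.≤ p ℚ.* q
0≤* {p} {q} 0≤p 0≤q = ℚ.≤-trans (ℚ.≤-reflexive (sym (ℚ.*-zeroˡ q))) (*-monoʳ-≤ 0≤q 0≤p)

numerator : ∀ q → 0ℚ ℚ.≤ q → ∃[ a ] q ≡ ι a ℚ.* (+ 1 ℚ./ ℚ.↧ₙ q)
numerator q@(ℚ.mkℚ (+ a) d-1 _) _ = a , trans (sym (ℚ.↥p/↧p≡p q)) (/-as-* a (suc d-1))
numerator (ℚ.mkℚ -[1+ _ ] _ _) (ℚ.*≤* ())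

-- Finitely many nonnegative rationals q j are natural multiples a j of one
-- unit δ = 1/N.
commonUnit : ∀ {n} (q : Fin n → ℚ) → (∀ j → 0ℚ ℚ.≤ q j) →
  ∃[ N ] ∃[ δ ] Σ[ a ∈ (Fin n → ℕ) ] (ι N ℚ.* δ ≡ 1ℚ × 0ℚ ℚ.≤ δ × (∀ j → q j ≡ ι (a j) ℚ.* δ))
commonUnit {zero} q _ = 1 , 1ℚ , (λ ()) , trans (ℚ.*-identityʳ (ι 1)) ι-1 , ℚ.≤-trans (0≤ι 1) (ℚ.≤-reflexive ι-1) , λ ()
commonUnit {suc n} q 0≤q
  with (N , δ , a , Nδ≡1 , 0≤δ , q≡) ← commonUnit (λ j → q (suc j)) (λ j → 0≤q (suc j))
     | (b , q₀≡) ← numerator (q zero) (0≤q zero)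
  = N ℕ.* d , δ ℚ.* ρ , a′ ,
    unit , 0≤* 0≤δ (0≤1/ d) , multiples
  where
  open ≡-Reasoning
  -- Including q zero refines the unit 1/N to 1/(N * d), d its denominator.
  d = ℚ.↧ₙ (q zero)
  a′ : Fin (suc n) → ℕ
  a′ zero    = b ℕ.* N
  a′ (suc j) = a j ℕ.* d
  ρ = + 1 ℚ./ d
  swap : ∀ x y z w → (x ℚ.* y) ℚ.* (z ℚ.* w) ≡ (x ℚ.* z) ℚ.* (y ℚ.* w)
  swap = solve 4 (λ x y z w → (x :* y) :* (z :* w) := (x :* z) :* (y :* w)) refl
  swap′ : ∀ x y z w → (x ℚ.* y) ℚ.* (z ℚ.* w) ≡ (x ℚ.* w) ℚ.* (y ℚ.* z)
  swap′ = solve 4 (λ x y z w → (x :* y) :* (z :* w) := (x :* w) :* (y :* z)) refl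
  unit : ι (N ℕ.* d) ℚ.* (δ ℚ.* ρ) ≡ 1ℚ
  unit = begin
    ι (N ℕ.* d) ℚ.* (δ ℚ.* ρ)             ≡⟨ cong (ℚ._* (δ ℚ.* ρ)) (ι-* N d) ⟩
    (ι N ℚ.* ι d) ℚ.* (δ ℚ.* ρ)           ≡⟨ swap (ι N) (ι d) δ ρ ⟩
    (ι N ℚ.* δ) ℚ.* (ι d ℚ.* ρ)           ≡⟨ cong₂ ℚ._*_ Nδ≡1 (ι-inverse d) ⟩
    1ℚ                                    ∎
  multiples : ∀ j → q j ≡ ι (a′ j) ℚ.* (δ ℚ.* ρ)
  multiples zero = sym (begin
    ι (b ℕ.* N) ℚ.* (δ ℚ.* ρ)             ≡⟨ cong (ℚ._* (δ ℚ.* ρ)) (ι-* b N) ⟩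
    (ι b ℚ.* ι N) ℚ.* (δ ℚ.* ρ)           ≡⟨ swap′ (ι b) (ι N) δ ρ ⟩
    (ι b ℚ.* ρ) ℚ.* (ι N ℚ.* δ)           ≡⟨ cong₂ ℚ._*_ (sym q₀≡) Nδ≡1 ⟩
    q zero ℚ.* 1ℚ                         ≡⟨ ℚ.*-identityʳ (q zero) ⟩
    q zero                                ∎)
  multiples (suc j) = sym (begin
    ι (a j ℕ.* d) ℚ.* (δ ℚ.* ρ)           ≡⟨ cong (ℚ._* (δ ℚ.* ρ)) (ι-* (a j) d) ⟩
    (ι (a j) ℚ.* ι d) ℚ.* (δ ℚ.* ρ)       ≡⟨ swap (ι (a j)) (ι d) δ ρ ⟩
    (ι (a j) ℚ.* δ) ℚ.* (ι d ℚ.* ρ)       ≡⟨ cong₂ ℚ._*_ (sym (q≡ j)) (ι-inverse d) ⟩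
    q (suc j) ℚ.* 1ℚ                      ≡⟨ ℚ.*-identityʳ (q (suc j)) ⟩
    q (suc j)                             ∎)

sumℚ-ι : ∀ {n} (a : Fin n → ℕ) δ → sumℚ (λ j → ι (a j) ℚ.* δ) ≡ ι (sumℕ a) ℚ.* δ
sumℚ-ι {zero}  a δ = sym (trans (cong (ℚ._* δ) ι-0) (ℚ.*-zeroˡ δ))
sumℚ-ι {suc n} a δ = begin
  ι (a zero) ℚ.* δ ℚ.+ sumℚ (λ j → ι (a (suc j)) ℚ.* δ)    ≡⟨ cong (ι (a zero) ℚ.* δ ℚ.+_) (sumℚ-ι (λ j → a (suc j)) δ) ⟩
  ι (a zero) ℚ.* δ ℚ.+ ι rest ℚ.* δ                        ≡⟨ ℚ.*-distribʳ-+ δ (ι (a zero)) (ι rest) ⟨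
  (ι (a zero) ℚ.+ ι rest) ℚ.* δ                            ≡⟨ cong (ℚ._* δ) (ι-+ (a zero) rest) ⟨
  ι (sumℕ a) ℚ.* δ                                         ∎
  where
  open ≡-Reasoning
  rest = sumℕ λ j → a (suc j)

module _ {G : Graph} where
  open Graph G

  weightℚ-ι : ∀ {q : E → ℚ} {a : E → ℕ} {δ} → (∀ e → q e ≡ ι (a e) ℚ.* δ) →
              ∀ {u v} (p : Walk G u v) → weightℚ q p ≡ ι (weightℕ a p) ℚ.* δ
  weightℚ-ι {δ = δ} q≡ []           = sym (trans (cong (ℚ._* δ) ι-0) (ℚ.*-zeroˡ δ))
  weightℚ-ι {q} {a} {δ} q≡ (e by _ ∷ p) = begin
    q e ℚ.+ weightℚ q p                           ≡⟨ cong₂ ℚ._+_ (q≡ e) (weightℚ-ι q≡ p) ⟩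
    ι (a e) ℚ.* δ ℚ.+ ι (weightℕ a p) ℚ.* δ       ≡⟨ ℚ.*-distribʳ-+ δ (ι (a e)) (ι (weightℕ a p)) ⟨
    (ι (a e) ℚ.+ ι (weightℕ a p)) ℚ.* δ           ≡⟨ cong (ℚ._* δ) (ι-+ (a e) (weightℕ a p)) ⟨
    ι (a e ℕ.+ weightℕ a p) ℚ.* δ                 ∎
    where open ≡-Reasoning

-- If every set of edges whose deletion disconnects G has at least k members,
-- then, for nonnegative rational weights, any two vertices are joined by a path
-- that carries at most 1/k of the total weight.
lightPath : (G : Graph) → Connected G → ∀ {k} →
  (∀ S → ¬ ConnectedWithout G S → k ℕ.≤ ∣ S ∣) →
  (q : Graph.E G → ℚ) → (∀ e → 0ℚ ℚ.≤ q e) → ∀ u v →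
  Σ[ p ∈ Path G u v ] ι k ℚ.* weightℚ q (proj₁ p) ℚ.≤ sumℚ q
lightPath G conn {k} cut≥k q 0≤q u v
  with (_ , δ , a , _ , 0≤δ , q≡) ← commonUnit q 0≤q
  = (geodesic G conn a v u , geodesic-isPath G conn a v u) , (begin
    ι k ℚ.* weightℚ q (geodesic G conn a v u)     ≡⟨ cong (ι k ℚ.*_) (weightℚ-ι q≡ (geodesic G conn a v u)) ⟩
    ι k ℚ.* (ι D ℚ.* δ)                           ≡⟨ comm (ι k) (ι D) δ ⟩
    (ι D ℚ.* ι k) ℚ.* δ                           ≡⟨ cong (ℚ._* δ) (ι-* D k) ⟨
    ι (D ℕ.* k) ℚ.* δ                             ≤⟨ *-monoʳ-≤ 0≤δ (ι-mono (ℕ.≤-trans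
                                                       (variation-bound G cut≥k D (distℕ G conn a v) refl (distℕ-self G conn a v))
                                                       (distℕ-variation G conn a v))) ⟩
    ι (sumℕ a) ℚ.* δ                              ≡⟨ sumℚ-ι a δ ⟨
    sumℚ (λ e → ι (a e) ℚ.* δ)                    ≡⟨ sumℚ-cong q≡ ⟨
    sumℚ q                                        ∎)
  where
  open ℚ.≤-Reasoning
  D : ℕ
  D = distℕ G conn a v u
  comm : ∀ x y z → x ℚ.* (y ℚ.* z) ≡ (y ℚ.* x) ℚ.* z
  comm = solve 3 (λ x y z → x :* (y :* z) := (y :* x) :* z) refl

*-swapʳ : ∀ x y z → (x ℚ.* y) ℚ.* z ≡ (x ℚ.* z) ℚ.* y
*-swapʳ = solve 3 (λ x y z → (x :* y) :* z := (x :* z) :* y) refl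

0<* : ∀ {p q} → 0ℚ ℚ.< p → 0ℚ ℚ.< q → 0ℚ ℚ.< p ℚ.* q
0<* {p} {q} 0<p 0<q = ℚ.<-respˡ-≡ (ℚ.*-zeroʳ p) (ℚ.*-monoʳ-<-pos p {{ℚ.positive 0<p}} 0<q)

0<1/ : ∀ n .{{_ : NonZero n}} → 0ℚ ℚ.< + 1 ℚ./ n
0<1/ n = ℚ.positive⁻¹ (+ 1 ℚ./ n) {{ℚ.normalize-pos 1 n}}

1/≤1 : ∀ n .{{_ : NonZero n}} → + 1 ℚ./ n ℚ.≤ 1ℚ
1/≤1 n = begin
  + 1 ℚ./ n                   ≡⟨ ℚ.*-identityˡ (+ 1 ℚ./ n) ⟨
  1ℚ ℚ.* (+ 1 ℚ./ n)          ≡⟨ cong (ℚ._* (+ 1 ℚ./ n)) ι-1 ⟨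
  ι 1 ℚ.* (+ 1 ℚ./ n)         ≤⟨ *-monoʳ-≤ (0≤1/ n) (ι-mono (ℕ.>-nonZero⁻¹ n)) ⟩
  ι n ℚ.* (+ 1 ℚ./ n)         ≡⟨ ι-inverse n ⟩
  1ℚ                          ∎
  where open ℚ.≤-Reasoning

ι-suc-* : ∀ n x → x ℚ.+ ι n ℚ.* x ≡ ι (suc n) ℚ.* x
ι-suc-* n x = sym (begin
  ι (suc n) ℚ.* x                   ≡⟨ cong (ℚ._* x) (ι-+ 1 n) ⟩
  (ι 1 ℚ.+ ι n) ℚ.* x               ≡⟨ ℚ.*-distribʳ-+ x (ι 1) (ι n) ⟩
  ι 1 ℚ.* x ℚ.+ ι n ℚ.* x           ≡⟨ cong (λ y → y ℚ.* x ℚ.+ ι n ℚ.* x) ι-1 ⟩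
  1ℚ ℚ.* x ℚ.+ ι n ℚ.* x            ≡⟨ cong (ℚ._+ ι n ℚ.* x) (ℚ.*-identityˡ x) ⟩
  x ℚ.+ ι n ℚ.* x                   ∎)
  where open ≡-Reasoning

-- Finite sums of rationals

sumℚ-≤ : ∀ {n} (f : Fin n → ℚ) {B} → (∀ j → f j ℚ.≤ B) → sumℚ f ℚ.≤ ι n ℚ.* B
sumℚ-≤ {zero}  f {B} f≤B = ℚ.≤-reflexive (sym (trans (cong (ℚ._* B) ι-0) (ℚ.*-zeroˡ B)))
sumℚ-≤ {suc n} f {B} f≤B = ℚ.≤-trans
  (ℚ.+-mono-≤ (f≤B zero) (sumℚ-≤ (λ j → f (suc j)) λ j → f≤B (suc j)))
  (ℚ.≤-reflexive (ι-suc-* n B))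

0≤sumℚ : ∀ {n} (f : Fin n → ℚ) → (∀ j → 0ℚ ℚ.≤ f j) → 0ℚ ℚ.≤ sumℚ f
0≤sumℚ {zero}  f 0≤f = ℚ.≤-refl
0≤sumℚ {suc n} f 0≤f = ℚ.+-mono-≤ (0≤f zero) (0≤sumℚ (λ j → f (suc j)) λ j → 0≤f (suc j))

sumℚ-shift : ∀ {n} (f : Fin n → ℚ) η → sumℚ (λ j → f j ℚ.+ η) ≡ sumℚ f ℚ.+ ι n ℚ.* η
sumℚ-shift {zero}  f η = sym (trans (ℚ.+-identityˡ _) (trans (cong (ℚ._* η) ι-0) (ℚ.*-zeroˡ η)))
sumℚ-shift {suc n} f η = begin
  (f zero ℚ.+ η) ℚ.+ sumℚ (λ j → f (suc j) ℚ.+ η)     ≡⟨ cong ((f zero ℚ.+ η) ℚ.+_) (sumℚ-shift (λ j → f (suc j)) η) ⟩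
  (f zero ℚ.+ η) ℚ.+ (rest ℚ.+ ι n ℚ.* η)             ≡⟨ swap (f zero) η rest (ι n ℚ.* η) ⟩
  (f zero ℚ.+ rest) ℚ.+ (η ℚ.+ ι n ℚ.* η)             ≡⟨ cong ((f zero ℚ.+ rest) ℚ.+_) (ι-suc-* n η) ⟩
  sumℚ f ℚ.+ ι (suc n) ℚ.* η                          ∎
  where
  open ≡-Reasoning
  rest = sumℚ λ j → f (suc j)
  swap : ∀ x y z w → (x ℚ.+ y) ℚ.+ (z ℚ.+ w) ≡ (x ℚ.+ z) ℚ.+ (y ℚ.+ w)
  swap = solve 4 (λ x y z w → (x :+ y) :+ (z :+ w) := (x :+ z) :+ (y :+ w)) refl

-- Sums and extrema of reals at a fixed index

seq-∑ : ∀ {n} (x : Fin n → ℝ) i → seq (∑ x) i ≡ sumℚ (λ j → seq (x j) i)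
seq-∑ {zero}  x i = refl
seq-∑ {suc n} x i = cong (seq (x zero) i ℚ.+_) (seq-∑ (λ j → x (suc j)) i)

seq-⊓-lower : ∀ {i c b} xs → c ℚ.≤ seq b i → All (λ x → c ℚ.≤ seq x i) xs →
              c ℚ.≤ seq (foldr _⊓_ b xs) i
seq-⊓-lower []       c≤b []         = c≤b
seq-⊓-lower (x ∷ xs) c≤b (c≤x ∷ c≤) = ℚ.⊓-glb c≤x (seq-⊓-lower xs c≤b c≤)

seq-⊓-≤ : ∀ {i x b xs} → x ∈ xs → seq (foldr _⊓_ b xs) i ℚ.≤ seq x i
seq-⊓-≤ {i} {x} {b} {_ ∷ xs} (here refl)  = ℚ.p⊓q≤p (seq x i) (seq (foldr _⊓_ b xs) i)
seq-⊓-≤ {i} {x} {b} {y ∷ xs} (there x∈xs) =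
  ℚ.≤-trans (ℚ.p⊓q≤q (seq y i) (seq (foldr _⊓_ b xs) i)) (seq-⊓-≤ {b = b} x∈xs)

seq-⊔-upper : ∀ {n i c b} (f : Fin n → ℝ) → seq b i ℚ.≤ c → (∀ j → seq (f j) i ℚ.≤ c) →
              seq (Vector.foldr _⊔_ b f) i ℚ.≤ c
seq-⊔-upper {zero}  f b≤c f≤c = b≤c
seq-⊔-upper {suc n} f b≤c f≤c = ℚ.⊔-lub (f≤c zero) (seq-⊔-upper (λ j → f (suc j)) b≤c λ j → f≤c (suc j))

seq-⊔-base : ∀ {n} i b (f : Fin n → ℝ) → seq b i ℚ.≤ seq (Vector.foldr _⊔_ b f) i
seq-⊔-base {zero}  i b f = ℚ.≤-refl
seq-⊔-base {suc n} i b f = ℚ.≤-trans (seq-⊔-base i b rest)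
  (ℚ.p≤q⊔p (seq (f zero) i) (seq (Vector.foldr _⊔_ b rest) i))
  where
  rest : Fin n → ℝ
  rest j = f (suc j)

eventually-all : ∀ {n} {P : Fin n → ℕ → Set} →
  (∀ j → ∃[ N ] (∀ i → N ℕ.≤ i → P j i)) → ∃[ N ] (∀ i → N ℕ.≤ i → ∀ j → P j i)
eventually-all {zero}  h = 0 , λ _ _ ()
eventually-all {suc n} {P} h
  with (M , f) ← h zero
     | (N , g) ← eventually-all (λ j → h (suc j))
  = M ℕ.⊔ N , both
  where
  both : ∀ i → M ℕ.⊔ N ℕ.≤ i → ∀ j → P j i
  both i ≤i zero    = f i (ℕ.m⊔n≤o⇒m≤o M N ≤i)
  both i ≤i (suc j) = g i (ℕ.m⊔n≤o⇒n≤o M N ≤i) j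

-- Bounds on the average eccentricity

module _ (G : Graph) (conn : Connected G) (w : Weight G) where
  open Graph G

  end∈vertices : ∀ {u v} (p : Walk G u v) → v ∈ vertices p
  end∈vertices []           = here refl
  end∈vertices (_ by _ ∷ p) = there (end∈vertices p)

  -- A path from a vertex to itself is empty.
  closed-path-weight : ∀ i {v} (p : Walk G v v) → IsPath p → 0ℚ ℚ.≤ seq (pathWeight G w p) i
  closed-path-weight i []           _          = ℚ.≤-refl
  closed-path-weight i (_ by _ ∷ p) (v∉p ∷ _) = ⊥-elim (All.lookup v∉p (end∈vertices p) refl)

  0≤dist-self : ∀ i v → 0ℚ ℚ.≤ seq (dist G conn w v v) i
  0≤dist-self i v = seq-⊓-lower (map (pathWeight G w) (paths G v v))
    (closed-path-weight i (proj₁ (conn v v)) (proj₂ (conn v v)))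
    (map⁺ (All.map (λ {p} → closed-path-weight i p) (paths-are-paths G conn v v)))

  0≤ecc : ∀ i v → 0ℚ ℚ.≤ seq (ecc G conn w v) i
  0≤ecc i v = ℚ.≤-trans (0≤dist-self i v) (seq-⊔-base i (dist G conn w v v) λ u → dist G conn w u v)

  0≤avec : ∀ i → 0ℚ ℚ.≤ seq (avec G conn w) i
  0≤avec i = 0≤* {seq (∑ (ecc G conn w)) i} {+ 1 ℚ./ ∣V∣}
    (subst (0ℚ ℚ.≤_) (sym (seq-∑ (ecc G conn w) i)) (0≤sumℚ _ (0≤ecc i))) (0≤1/ ∣V∣)

  dist≤weightℚ : ∀ i (q : E → ℚ) → (∀ e → seq (w e) i ℚ.≤ q e) →
                 ∀ {u v} ((p , _) : Path G u v) → seq (dist G conn w u v) i ℚ.≤ weightℚ q p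
  dist≤weightℚ i q w≤q (p , path) =
    ℚ.≤-trans (seq-⊓-≤ (∈-map⁺ (pathWeight G w) (paths-complete G (p , path)))) (bound p)
    where
    bound : ∀ {u v} (p : Walk G u v) → seq (pathWeight G w p) i ℚ.≤ weightℚ q p
    bound []           = ℚ.≤-refl
    bound (e by _ ∷ p) = ℚ.+-mono-≤ (w≤q e) (bound p)

  avec-upper : ∀ i {c} → (∀ u v → seq (dist G conn w u v) i ℚ.≤ c) → seq (avec G conn w) i ℚ.≤ c
  avec-upper i {c} dist≤c = begin
    seq (∑ (ecc G conn w)) i ℚ.* r                     ≡⟨ cong (ℚ._* r) (seq-∑ (ecc G conn w) i) ⟩
    sumℚ (λ v → seq (ecc G conn w v) i) ℚ.* r          ≤⟨ *-monoʳ-≤ (0≤1/ ∣V∣) (sumℚ-≤ (λ v → seq (ecc G conn w v) i) ecc≤c) ⟩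
    (ι ∣V∣ ℚ.* c) ℚ.* r                                ≡⟨ *-swapʳ (ι ∣V∣) c r ⟩
    (ι ∣V∣ ℚ.* r) ℚ.* c                                ≡⟨ cong (ℚ._* c) (ι-inverse ∣V∣) ⟩
    1ℚ ℚ.* c                                           ≡⟨ ℚ.*-identityˡ c ⟩
    c                                                  ∎
    where
    open ℚ.≤-Reasoning
    r : ℚ
    r = + 1 ℚ./ ∣V∣
    ecc≤c : ∀ v → seq (ecc G conn w v) i ℚ.≤ c
    ecc≤c v = seq-⊔-upper (λ u → dist G conn w u v) (dist≤c v v) λ u → dist≤c u v

  module _ {k : ℕ} {{_ : NonZero k}} (cut≥k : ∀ S → ¬ ConnectedWithout G S → k ℕ.≤ ∣ S ∣)
           (w-nonNeg : NonNegative G w) (w-sum : ∑ w ≤ fromℕ ∣E∣) where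

    dist-upper : ∀ ε → 0ℚ ℚ.< ε → ∃[ N ] (∀ i → N ℕ.≤ i → ∀ u v →
                 seq (dist G conn w u v) i ℚ.≤ seq (fromℕ ∣E∣ ÷ k) i ℚ.+ ε)
    dist-upper ε 0<ε = M ℕ.⊔ N , λ i ≤i →
      bound i (sum≤ i (ℕ.m⊔n≤o⇒m≤o M N ≤i)) (nonNeg i (ℕ.m⊔n≤o⇒n≤o M N ≤i))
      where
      open ℚ.≤-Reasoning
      -- Raising every weight by θ absorbs the possible negativity at index i.
      -- The total then grows by ∣E∣ * θ <= η, and the sum of the weights may
      -- exceed m = ∣E∣ by another η, which makes ε together.  The factor
      -- 1/(1 + ∣E∣) avoids division by zero.
      r m η θ : ℚ
      r = + 1 ℚ./ k
      m = + ∣E∣ ℚ./ 1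
      η = ½ ℚ.* ε
      θ = η ℚ.* (+ 1 ℚ./ suc ∣E∣)

      0<½ : 0ℚ ℚ.< ½
      0<½ = ℚ.positive⁻¹ ½

      0<η : 0ℚ ℚ.< η
      0<η = 0<* 0<½ 0<ε

      0<θ : 0ℚ ℚ.< θ
      0<θ = 0<* 0<η (0<1/ (suc ∣E∣))

      mθ≤η : ι ∣E∣ ℚ.* θ ℚ.≤ η
      mθ≤η = begin
        ι ∣E∣ ℚ.* θ                                     ≤⟨ *-monoʳ-≤ (ℚ.<⇒≤ 0<θ) (ι-mono (ℕ.n≤1+n ∣E∣)) ⟩
        ι (suc ∣E∣) ℚ.* (η ℚ.* (+ 1 ℚ./ suc ∣E∣))       ≡⟨ comm (ι (suc ∣E∣)) η (+ 1 ℚ./ suc ∣E∣) ⟩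
        (ι (suc ∣E∣) ℚ.* (+ 1 ℚ./ suc ∣E∣)) ℚ.* η       ≡⟨ cong (ℚ._* η) (ι-inverse (suc ∣E∣)) ⟩
        1ℚ ℚ.* η                                        ≡⟨ ℚ.*-identityˡ η ⟩
        η                                               ∎
        where
        comm : ∀ x y z → x ℚ.* (y ℚ.* z) ≡ (x ℚ.* z) ℚ.* y
        comm = solve 3 (λ x y z → x :* (y :* z) := (x :* z) :* y) refl

      M = proj₁ (w-sum η 0<η)
      sum≤ = proj₂ (w-sum η 0<η)

      nonNegative-from : ∃[ N ] (∀ i → N ℕ.≤ i → ∀ e → 0ℚ ℚ.≤ seq (w e) i ℚ.+ θ)
      nonNegative-from = eventually-all λ e → w-nonNeg e θ 0<θ

      N = proj₁ nonNegative-from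
      nonNeg = proj₂ nonNegative-from

      bound : ∀ i → seq (∑ w) i ℚ.≤ m ℚ.+ η → (∀ e → 0ℚ ℚ.≤ seq (w e) i ℚ.+ θ) →
              ∀ u v → seq (dist G conn w u v) i ℚ.≤ m ℚ.* r ℚ.+ ε
      bound i Σw≤ 0≤q u v = begin
        seq (dist G conn w u v) i             ≤⟨ dist≤weightℚ i q w≤q path ⟩
        d                                     ≡⟨ ℚ.*-identityˡ d ⟨
        1ℚ ℚ.* d                              ≡⟨ cong (ℚ._* d) (ι-inverse k) ⟨
        (ι k ℚ.* r) ℚ.* d                     ≡⟨ *-swapʳ (ι k) r d ⟩
        (ι k ℚ.* d) ℚ.* r                     ≤⟨ *-monoʳ-≤ (0≤1/ k) (ℚ.≤-trans light Σq≤) ⟩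
        (m ℚ.+ ε) ℚ.* r                       ≡⟨ ℚ.*-distribʳ-+ r m ε ⟩
        m ℚ.* r ℚ.+ ε ℚ.* r                   ≤⟨ ℚ.+-monoʳ-≤ (m ℚ.* r) (*-monoˡ-≤ (ℚ.<⇒≤ 0<ε) (1/≤1 k)) ⟩
        m ℚ.* r ℚ.+ ε ℚ.* 1ℚ                  ≡⟨ cong (m ℚ.* r ℚ.+_) (ℚ.*-identityʳ ε) ⟩
        m ℚ.* r ℚ.+ ε                         ∎
        where
        q : E → ℚ
        q e = seq (w e) i ℚ.+ θ
        lightest = lightPath G conn cut≥k q 0≤q u v
        path  = proj₁ lightest
        light = proj₂ lightest
        d : ℚ
        d = weightℚ q (proj₁ path)
        w≤q : ∀ e → seq (w e) i ℚ.≤ q e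
        w≤q e = ℚ.≤-trans (ℚ.≤-reflexive (sym (ℚ.+-identityʳ (seq (w e) i))))
                  (ℚ.+-monoʳ-≤ (seq (w e) i) (ℚ.<⇒≤ 0<θ))
        Σq≤ : sumℚ q ℚ.≤ m ℚ.+ ε
        Σq≤ = begin
          sumℚ q                                          ≡⟨ sumℚ-shift (λ e → seq (w e) i) θ ⟩
          sumℚ (λ e → seq (w e) i) ℚ.+ ι ∣E∣ ℚ.* θ        ≡⟨ cong (ℚ._+ ι ∣E∣ ℚ.* θ) (seq-∑ w i) ⟨
          seq (∑ w) i ℚ.+ ι ∣E∣ ℚ.* θ                     ≤⟨ ℚ.+-mono-≤ Σw≤ mθ≤η ⟩
          (m ℚ.+ η) ℚ.+ η                                 ≡⟨ ℚ.+-assoc m η η ⟩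
          m ℚ.+ (η ℚ.+ η)                                 ≡⟨ cong (m ℚ.+_) (ℚ.*-distribʳ-+ ε ½ ½) ⟨
          m ℚ.+ 1ℚ ℚ.* ε                                  ≡⟨ cong (m ℚ.+_) (ℚ.*-identityˡ ε) ⟩
          m ℚ.+ ε                                         ∎

theorem3p4 : (G : Graph) (conn : Connected G) → ¬ IsTree G →
    (k : ℕ) (isλ : IsEdgeConnectivity G k) →
    (w : Weight G) → NonNegative G w → Normalised G w →
    0ℝ ≤ avec G conn w ×
    avec G conn w ≤ (fromℕ (Graph.∣E∣ G) ÷ k) {{edgeConnectivity-nonZero G conn isλ}}
theorem3p4 G conn _ k isλ@(_ , cut≥k) w w-nonNeg (w-sum , _) = lower , upper
  where
  instance
    k-nonZero : NonZero k
    k-nonZero = edgeConnectivity-nonZero G conn isλ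

  lower : 0ℝ ≤ avec G conn w
  lower ε 0<ε = 0 , λ i _ → ℚ.+-mono-≤ (0≤avec G conn w i) (ℚ.<⇒≤ 0<ε)

  upper : avec G conn w ≤ fromℕ (Graph.∣E∣ G) ÷ k
  upper ε 0<ε =
    let (N , dist≤) = dist-upper G conn w cut≥k w-nonNeg w-sum ε 0<ε
    in N , λ i N≤i → avec-upper G conn w i (dist≤ i N≤i)
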